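{- For all integers $r,s,k\in\mathbb{Z}$ and every integer $n\ge 0$, $$s_{n}^{(r,k)}(x)=\sum_{m=0}^{n}\binom{n}{m}s_{n-m}^{(r-s,k)}\,\mathbb{B}_{m}^{(s)}(x)$$ as polynomials in $x$.
   Context: For $k\in\mathbb{Z}$, $Li_k(x)=\sum_{n=1}^{\infty}\frac{x^n}{n^k}$ is the polylogarithm, regarded as a formal power series; $\frac{Li_k(1-e^{ -t})}{1-e^{ -t}}$ is then a formal power series in $t$ over $\mathbb{C}$. For $r\in\mathbb{Z}$, the Bernoulli polynomials of order $r$, $\mathbb{B}_n^{(r)}(x)$, are defined by $\left(\frac{t}{e^t-1}\right)^r e^{xt}=\sum_{n\ge0}\mathbb{B}_n^{(r)}(x)\frac{t^n}{n!}$. For $r,k\in\mathbb{Z}$, the higher-order Bernoulli and poly-Bernoulli mixed type polynomials $s_n^{(r,k)}(x)$ are defined by $\left(\frac{t}{e^t-1}\right)^r\frac{Li_k(1-e^{ -t})}{1-e^{ -t}}e^{xt}=\sum_{n\ge0}s_n^{(r,k)}(x)\frac{t^n}{n!}$, and $s_n^{(r,k)}=s_n^{(r,k)}(0)$. -}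

module Defs where

open import Algebra.Apartness.Bundles using (HeytingCommutativeRing; HeytingField)
open import Algebra.Bundles using (CommutativeRing)
open import Algebra.Bundles.Raw using (RawRing)
import Algebra.Definitions as AlgebraDefinitions
import Algebra.Definitions.RawSemiring as RawSemiringDefinitions
import Algebra.Properties.Monoid.Sum as MonoidSum
import Algebra.Properties.Ring as RingProperties
open import Data.Fin.Base using (Fin; zero; suc; toℕ)
open import Data.Integer.Base as ℤ using (ℤ; +_; -[1+_])
open import Data.List.Base using (List; []; _∷_; map)
open import Data.Nat.Base using (ℕ; zero; suc; _∸_; _!; NonZero)
open import Data.Nat.Properties using (_!≢0)
open import Data.Product.Base using (_,_; proj₁; proj₂)
open import Data.Vec.Base as Vec using (Vec; []; _∷_; head; lookup)
open import Function.Base using (_∘_)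
open import Level using (Level)
open import Relation.Binary.PropositionalEquality.Core as ≡ using (_≡_)
import Relation.Binary.Reasoning.Setoid as SetoidReasoning

private
  variable
    c ℓ ℓ₁ ℓ₂ : Level

module RawRingExtras (R : RawRing c ℓ) where

  open RawRing R
  open AlgebraDefinitions _≈_ using (RightInvertible)
  open RawSemiringDefinitions rawSemiring public using (_×_; _^_; sum)

  Unit : Carrier → Set _
  Unit = RightInvertible 1# _*_

  sumUpTo : ℕ → (ℕ → Carrier) → Carrier
  sumUpTo n f = sum {suc n} (f ∘ toℕ)

  infixl 10 sumUpTo
  syntax sumUpTo n (λ i → x) = ∑[ i ≤ n ] x

  powℤ : (x : Carrier) → Unit x → ℤ → Carrier
  powℤ x _         (+ n)    = x ^ n
  powℤ x (x⁻¹ , _) -[1+ n ] = x⁻¹ ^ suc n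

module PowerSeries (R : RawRing c ℓ) where

  open RawRing R
  open RawRingExtras R using (sumUpTo)

  Series : Set c
  Series = ℕ → Carrier

  constant : Carrier → Series
  constant a zero    = a
  constant a (suc _) = 0#

  t : Series
  t 1 = 1#
  t _ = 0#

  rawRing : RawRing c ℓ
  rawRing = record
    { Carrier = Series
    ; _≈_     = λ f g → ∀ n → f n ≈ g n
    ; _+_     = λ f g n → f n + g n
    ; _*_     = λ f g n → ∑[ i ≤ n ] (f i * g (n ∸ i))
    ; -_      = λ f n → - f n
    ; 0#      = constant 0#
    ; 1#      = constant 1#
    }

  -- Substitution f(g), for g with zero constant term: then gᵐ only has terms
  -- of degree at least m, so truncating the sum at m = n loses nothing.
  compose : Series → Series → Series
  compose f g n = ∑[ m ≤ n ] (f m * RawRingExtras._^_ rawRing g m n)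

  -- f / t, for f with zero constant term.
  divideByT : Series → Series
  divideByT f = f ∘ suc

module PowerSeriesDivision (R : CommutativeRing c ℓ) where

  open CommutativeRing R
  open PowerSeries rawRing using (Series; divideByT) renaming (rawRing to seriesRawRing)
  open RawRing seriesRawRing using () renaming (_*_ to _*ₛ_)
  open RawRingExtras rawRing using (Unit; sum)
  open RawRingExtras seriesRawRing using () renaming (Unit to Unitₛ)
  open MonoidSum +-monoid using (sum-cong-≗)
  open RingProperties ring using (-‿distribʳ-*)
  open SetoidReasoning setoid

  -- Coefficients n, n-1, …, 0 of f⁻¹, where u is the inverse of f 0; from
  -- f₀ gₙ₊₁ + Σ_{i ≤ n} fᵢ₊₁ gₙ₋ᵢ = 0.
  inverseCoeffs : Series → Carrier → (n : ℕ) → Vec Carrier (suc n)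
  inverseCoeffs f u zero    = u ∷ []
  inverseCoeffs f u (suc n) = - (u * sum (λ i → f (suc (toℕ i)) * lookup gs i)) ∷ gs
    where gs = inverseCoeffs f u n

  inverseSeries : Series → Carrier → Series
  inverseSeries f u n = head (inverseCoeffs f u n)

  lookup-inverseCoeffs : ∀ f u n (i : Fin (suc n)) →
    lookup (inverseCoeffs f u n) i ≡ inverseSeries f u (n ∸ toℕ i)
  lookup-inverseCoeffs f u zero    zero    = ≡.refl
  lookup-inverseCoeffs f u (suc n) zero    = ≡.refl
  lookup-inverseCoeffs f u (suc n) (suc i) = lookup-inverseCoeffs f u n i

  invert : (f : Series) → Unit (f 0) → Unitₛ f
  invert f (u , f₀u≈1) = inverseSeries f u , correct
    where
    correct : ∀ n → (f *ₛ inverseSeries f u) n ≈ RawRing.1# seriesRawRing n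
    correct zero    = trans (+-identityʳ _) f₀u≈1
    correct (suc n) = begin
      f 0 * - (u * S) + S′     ≈⟨ +-congʳ (-‿distribʳ-* (f 0) (u * S)) ⟨
      - (f 0 * (u * S)) + S′   ≈⟨ +-congʳ (-‿cong (*-assoc (f 0) u S)) ⟨
      - ((f 0 * u) * S) + S′   ≈⟨ +-congʳ (-‿cong (trans (*-congʳ f₀u≈1) (*-identityˡ S))) ⟩
      - S + S′                 ≡⟨ ≡.cong (λ z → - S + z) S≡S′ ⟨
      - S + S                  ≈⟨ -‿inverseˡ S ⟩
      0#                       ∎
      where
      term term′ : Fin (suc n) → Carrier
      term  i = f (suc (toℕ i)) * lookup (inverseCoeffs f u n) i
      term′ i = f (suc (toℕ i)) * inverseSeries f u (n ∸ toℕ i)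
      S S′ : Carrier
      S  = sum term
      S′ = sum term′
      S≡S′ : S ≡ S′
      S≡S′ = sum-cong-≗ (λ i → ≡.cong (f (suc (toℕ i)) *_) (lookup-inverseCoeffs f u n i))

  -- f / g, for f and g with zero constant term and g₁ invertible, computed as
  -- (f / t) (g / t)⁻¹.
  quotient : (f g : Series) → Unit (g 1) → Series
  quotient f g g₁-unit = divideByT f *ₛ proj₁ (invert (divideByT g) g₁-unit)

  quotient-unit : ∀ f g (g₁-unit : Unit (g 1)) → Unit (f 1) → Unit (quotient f g g₁-unit 0)
  quotient-unit f g (u , g₁u≈1) (v , f₁v≈1) = g 1 * v , (begin
    (f 1 * u + 0#) * (g 1 * v)  ≈⟨ *-congʳ (+-identityʳ _) ⟩
    (f 1 * u) * (g 1 * v)       ≈⟨ *-assoc (f 1) u (g 1 * v) ⟩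
    f 1 * (u * (g 1 * v))       ≈⟨ *-congˡ (*-assoc u (g 1) v) ⟨
    f 1 * ((u * g 1) * v)       ≈⟨ *-congˡ (*-congʳ (trans (*-comm u (g 1)) g₁u≈1)) ⟩
    f 1 * (1# * v)              ≈⟨ *-congˡ (*-identityˡ v) ⟩
    f 1 * v                     ≈⟨ f₁v≈1 ⟩
    1#                          ∎)

-- A polynomial in x is the list of its coefficients, constant term first;
-- equality is coefficientwise, so trailing zeros are irrelevant.

module Polynomials (R : RawRing c ℓ) where

  open RawRing R

  Poly : Set c
  Poly = List Carrier

  coeff : Poly → ℕ → Carrier
  coeff []      _       = 0#
  coeff (a ∷ p) zero    = a
  coeff (a ∷ p) (suc n) = coeff p n

  const : Carrier → Poly
  const a = a ∷ []

  X : Poly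
  X = 0# ∷ 1# ∷ []

  add : Poly → Poly → Poly
  add []      q       = q
  add (a ∷ p) []      = a ∷ p
  add (a ∷ p) (b ∷ q) = (a + b) ∷ add p q

  mul : Poly → Poly → Poly
  mul []      q = []
  mul (a ∷ p) q = add (map (a *_) q) (0# ∷ mul p q)

  eval : Poly → Carrier → Carrier
  eval []      a = 0#
  eval (b ∷ p) a = b + a * eval p a

  rawRing : RawRing c ℓ
  rawRing = record
    { Carrier = Poly
    ; _≈_     = λ p q → ∀ n → coeff p n ≈ coeff q n
    ; _+_     = add
    ; _*_     = mul
    ; -_      = map (-_)
    ; 0#      = []
    ; 1#      = const 1#
    }

commutativeRing : HeytingField c ℓ₁ ℓ₂ → CommutativeRing c ℓ₁
commutativeRing K = HeytingCommutativeRing.commutativeRing (HeytingField.heytingCommutativeRing K)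

CharacteristicZero : HeytingField c ℓ₁ ℓ₂ → Set ℓ₂
CharacteristicZero K = ∀ n → .{{NonZero n}} → (n × 1#) # 0#
  where
  open HeytingField K using (_#_; 0#; 1#)
  open RawRingExtras (CommutativeRing.rawRing (commutativeRing K)) using (_×_)

module BernoulliMixed (K : HeytingField c ℓ₁ ℓ₂) (char0 : CharacteristicZero K) where

  open HeytingField K using (#⇒invertible)
  open CommutativeRing (commutativeRing K)
  open RawRingExtras rawRing using (Unit; _×_; _^_; powℤ)
  open PowerSeries rawRing
    using (Series; t; compose) renaming (rawRing to seriesRawRing)
  open RawRing seriesRawRing using ()
    renaming (_+_ to _+ₛ_; _*_ to _*ₛ_; -_ to -ₛ_; 1# to 1ₛ)
  open RawRingExtras seriesRawRing using () renaming (Unit to Unitₛ; powℤ to powℤₛ)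
  open PowerSeriesDivision (commutativeRing K) using (invert; quotient; quotient-unit)
  open RingProperties ring using (-0#≈0#; -‿involutive)
  open SetoidReasoning setoid

  open Polynomials rawRing public using (Poly; coeff; const; X; eval)
    renaming (rawRing to polyRawRing)
  open RawRing polyRawRing public using ()
    renaming (_≈_ to _≈ₚ_; _*_ to _*ₚ_)
  open RawRingExtras polyRawRing public using (sumUpTo)
    renaming (_×_ to _×ₚ_; _^_ to _^ₚ_)

  ℕ-unit : ∀ n → .{{NonZero n}} → Unit (n × 1#)
  ℕ-unit n = let (u , _ , n-0·u≈1) = #⇒invertible (char0 n) in u , (begin
    (n × 1#) * u         ≈⟨ *-congʳ (+-identityʳ _) ⟨
    (n × 1# + 0#) * u    ≈⟨ *-congʳ (+-congˡ -0#≈0#) ⟨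
    (n × 1# - 0#) * u    ≈⟨ n-0·u≈1 ⟩
    1#                   ∎)

  1/! : ℕ → Carrier
  1/! n = proj₁ (ℕ-unit (n !) {{n !≢0}})

  -- e^{at}
  exp : Carrier → Series
  exp a n = 1/! n * a ^ n

  -- e^{xt}, with coefficients in K[x]
  exp-xt : ℕ → Poly
  exp-xt n = const (1/! n) *ₚ X ^ₚ n

  -- The coefficient 1 / nᵏ of the polylogarithm is computed as n⁻ᵏ.
  Li : ℤ → Series
  Li k zero      = 0#
  Li k n@(suc _) = powℤ (n × 1#) (ℕ-unit n) (ℤ.- k)

  e^t-1 : Series
  e^t-1 = exp 1# +ₛ (-ₛ 1ₛ)

  1-e^-t : Series
  1-e^-t = 1ₛ +ₛ (-ₛ exp (- 1#))

  1-unit : ∀ {a} → a ≈ 1# → Unit a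
  1-unit a≈1 = 1# , trans (*-identityʳ _) a≈1

  1/1!≈1 : 1/! 1 ≈ 1#
  1/1!≈1 = begin
    1/! 1              ≈⟨ *-identityˡ _ ⟨
    1# * 1/! 1         ≈⟨ *-congʳ (+-identityʳ 1#) ⟨
    (1 × 1#) * 1/! 1   ≈⟨ proj₂ (ℕ-unit 1) ⟩
    1#                  ∎

  e^t-1-unit : Unit (e^t-1 1)
  e^t-1-unit = 1-unit (begin
    1/! 1 * (1# * 1#) + - 0#   ≈⟨ +-congˡ -0#≈0# ⟩
    1/! 1 * (1# * 1#) + 0#     ≈⟨ +-identityʳ _ ⟩
    1/! 1 * (1# * 1#)          ≈⟨ *-cong 1/1!≈1 (*-identityˡ 1#) ⟩
    1# * 1#                     ≈⟨ *-identityˡ 1# ⟩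
    1#                          ∎)

  1-e^-t-unit : Unit (1-e^-t 1)
  1-e^-t-unit = 1-unit (begin
    0# + - (1/! 1 * (- 1# * 1#))   ≈⟨ +-identityˡ _ ⟩
    - (1/! 1 * (- 1# * 1#))        ≈⟨ -‿cong (*-cong 1/1!≈1 (*-identityʳ (- 1#))) ⟩
    - (1# * - 1#)                   ≈⟨ -‿cong (*-identityˡ (- 1#)) ⟩
    - - 1#                          ≈⟨ -‿involutive 1# ⟩
    1#                              ∎)

  t/[e^t-1] : Series
  t/[e^t-1] = quotient t e^t-1 e^t-1-unit

  t/[e^t-1]-unit : Unitₛ t/[e^t-1]
  t/[e^t-1]-unit = invert t/[e^t-1] (quotient-unit t e^t-1 e^t-1-unit (1-unit refl))

  [t/[e^t-1]]^_ : ℤ → Series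
  [t/[e^t-1]]^ r = powℤₛ t/[e^t-1] t/[e^t-1]-unit r

  -- Li_k(1 - e^{-t}) / (1 - e^{-t})
  polyBernoulliSeries : ℤ → Series
  polyBernoulliSeries k = quotient (compose (Li k) 1-e^-t) 1-e^-t 1-e^-t-unit

  -- The n-th coefficient, with respect to tⁿ/n!, of f e^{xt} ∈ K[x][[t]].
  appell : Series → ℕ → Poly
  appell f n = (n !) ×ₚ ((const ∘ f) *ₓ exp-xt) n
    where
    open RawRing (PowerSeries.rawRing polyRawRing) using () renaming (_*_ to _*ₓ_)

  𝔹 : ℤ → ℕ → Poly
  𝔹 r = appell ([t/[e^t-1]]^ r)

  -- The higher-order Bernoulli and poly-Bernoulli mixed type polynomial sₙ⁽ʳ'ᵏ⁾(x)
  -- and number sₙ⁽ʳ'ᵏ⁾.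
  s[x] : ℤ → ℤ → ℕ → Poly
  s[x] r k = appell (([t/[e^t-1]]^ r) *ₛ polyBernoulliSeries k)

  s[0] : ℤ → ℤ → ℕ → Carrier
  s[0] r k n = eval (s[x] r k n) 0#

{-# OPTIONS --safe #-}
-- With T = t/(eᵗ - 1) and L = Li_k(1 - e⁻ᵗ)/(1 - e⁻ᵗ), compare coefficients of tⁿ/n! in
-- Tʳ L e^{xt} = (Tʳ⁻ˢ L)(Tˢ e^{xt}), an identity in K[x][[t]]; the coefficients of the first
-- factor are the numbers s_n^{(r-s,k)} because e^{xt} is 1 at x = 0. The ring laws of K[x]
-- are inherited from K[[x]], into which K[x] embeds by taking coefficients.

module Submission where

open import Defs
open import Algebra.Apartness.Bundles using (HeytingField)
open import Algebra.Bundles using (AbelianGroup; CommutativeMonoid; CommutativeRing)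
open import Algebra.Bundles.Raw using (RawRing)
open import Algebra.Morphism.Structures using (IsRingHomomorphism; IsRingMonomorphism)
import Algebra.Morphism.Construct.Composition as Composition
import Algebra.Morphism.RingMonomorphism as RingMonomorphism
import Algebra.Properties.CommutativeMonoid.Sum as CommutativeMonoidSum
import Algebra.Properties.Monoid.Mult as MonoidMult
import Algebra.Properties.Semiring.Exp as SemiringExp
import Algebra.Properties.Semiring.Mult as SemiringMult
import Algebra.Properties.Semiring.Sum as SemiringSum
import Algebra.Properties.CommutativeSemigroup as CommutativeSemigroupProperties
import Algebra.Properties.Group as GroupProperties
import Algebra.Properties.Ring as RingProperties
open import Data.Fin.Base using (Fin; zero; suc; toℕ)
open import Data.Fin.Properties using (toℕ≤pred[n])
open import Data.Integer.Base as ℤ using (ℤ; _-_; +_; -[1+_]; _⊖_)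
import Data.Integer.Properties as ℤ
open import Data.List.Base using ([]; _∷_; map)
open import Data.Nat.Base as ℕ using (ℕ; zero; suc; _∸_; _!; _≤_)
open import Data.Nat.Combinatorics using (_C_; nCk≡n!/k![n-k]!; k![n∸k]!∣n!)
open import Data.Nat.DivMod using (m/n*n≡m)
import Data.Nat.Properties as ℕ
open import Data.Product.Base using (_,_; proj₁; proj₂)
open import Function.Base using (_∘_; id)
open import Level using (Level)
open import Relation.Binary.PropositionalEquality.Core as ≡ using (_≡_)
import Relation.Binary.Reasoning.Setoid as SetoidReasoning

private
  variable
    c ℓ c′ ℓ′ : Level

-- The commutative ring of formal power series.

module SeriesProperties (R : CommutativeRing c ℓ) where

  open CommutativeRing R
  open CommutativeSemigroupProperties +-commutativeSemigroup using (x∙yz≈y∙xz)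
  open PowerSeries rawRing using (Series) renaming (rawRing to seriesRawRing)
  open RawRing seriesRawRing using ()
    renaming (_≈_ to _≈ₛ_; _+_ to _+ₛ_; _*_ to _*ₛ_; -_ to -ₛ_; 0# to 0ₛ; 1# to 1ₛ)
  open SemiringSum semiring
    using (sum-cong-≋; sum-replicate-zero; ∑-distrib-+; *-distribˡ-sum)
  open SetoidReasoning setoid

  -- `constant 0#` splits on the index, so at a variable `n` it is stuck although both cases give
  -- `0#`.
  0ₛ≈0# : ∀ n → 0ₛ n ≈ 0#
  0ₛ≈0# zero    = refl
  0ₛ≈0# (suc n) = refl

  *ₛ-cong : ∀ {f f′ g g′} → f ≈ₛ f′ → g ≈ₛ g′ → (f *ₛ g) ≈ₛ (f′ *ₛ g′)
  *ₛ-cong f≈f′ g≈g′ n =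
    sum-cong-≋ {suc n} (λ i → *-cong (f≈f′ (toℕ i)) (g≈g′ (n ∸ toℕ i)))

  *ₛ-distribˡ : ∀ f g h → (f *ₛ (g +ₛ h)) ≈ₛ ((f *ₛ g) +ₛ (f *ₛ h))
  *ₛ-distribˡ f g h n = trans
    (sum-cong-≋ {suc n} (λ i → distribˡ (f (toℕ i)) (g (n ∸ toℕ i)) (h (n ∸ toℕ i))))
    (∑-distrib-+ {suc n} (λ i → f (toℕ i) * g (n ∸ toℕ i)) (λ i → f (toℕ i) * h (n ∸ toℕ i)))

  *ₛ-scaleˡ : ∀ a f g n → ((λ i → a * f i) *ₛ g) n ≈ a * (f *ₛ g) n
  *ₛ-scaleˡ a f g n = trans
    (sum-cong-≋ {suc n} (λ i → *-assoc a (f (toℕ i)) (g (n ∸ toℕ i))))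
    (sym (*-distribˡ-sum {suc n} a (λ i → f (toℕ i) * g (n ∸ toℕ i))))

  -- The zero series appears as `λ _ → 0#` because the tail of `1ₛ` and `coeff []` both reduce to
  -- this form, not to `0ₛ`.
  *ₛ-zeroˡ : ∀ g n → ((λ _ → 0#) *ₛ g) n ≈ 0#
  *ₛ-zeroˡ g n = trans
    (sum-cong-≋ {suc n} (λ i → zeroˡ (g (n ∸ toℕ i))))
    (sum-replicate-zero (suc n))

  -- The Cauchy product unfolds by computation at its first term, the one with `f 0`. This is the
  -- mirror recursion, at the last term; commutativity compares the two.
  *ₛ-suc : ∀ f g n → (f *ₛ g) (suc n) ≈ f (suc n) * g 0 + (f *ₛ (g ∘ suc)) n
  *ₛ-suc f g zero    = begin
    f 0 * g 1 + (f 1 * g 0 + 0#)  ≈⟨ x∙yz≈y∙xz _ _ _ ⟩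
    f 1 * g 0 + (f 0 * g 1 + 0#)  ∎
  *ₛ-suc f g (suc n) = begin
    f 0 * g (2 ℕ.+ n) + ((f ∘ suc) *ₛ g) (suc n)
      ≈⟨ +-congˡ (*ₛ-suc (f ∘ suc) g n) ⟩
    f 0 * g (2 ℕ.+ n) + (f (2 ℕ.+ n) * g 0 + ((f ∘ suc) *ₛ (g ∘ suc)) n)
      ≈⟨ x∙yz≈y∙xz _ _ _ ⟩
    f (2 ℕ.+ n) * g 0 + (f *ₛ (g ∘ suc)) (suc n)
      ∎

  -- Unfolding the left side at its first term and the right side at its last leaves remainders that
  -- differ only in the order of `f ∘ suc` and `g`, so the induction on the degree must keep the
  -- series arbitrary.
  *ₛ-comm : ∀ f g → (f *ₛ g) ≈ₛ (g *ₛ f)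
  *ₛ-comm f g zero    = +-congʳ (*-comm (f 0) (g 0))
  *ₛ-comm f g (suc n) = begin
    f 0 * g (suc n) + ((f ∘ suc) *ₛ g) n  ≈⟨ +-cong (*-comm _ _) (*ₛ-comm (f ∘ suc) g n) ⟩
    g (suc n) * f 0 + (g *ₛ (f ∘ suc)) n  ≈⟨ *ₛ-suc g f n ⟨
    (g *ₛ f) (suc n)                      ∎

  *ₛ-distribʳ : ∀ f g h → ((g +ₛ h) *ₛ f) ≈ₛ ((g *ₛ f) +ₛ (h *ₛ f))
  *ₛ-distribʳ f g h n = begin
    ((g +ₛ h) *ₛ f) n          ≈⟨ *ₛ-comm (g +ₛ h) f n ⟩
    (f *ₛ (g +ₛ h)) n          ≈⟨ *ₛ-distribˡ f g h n ⟩
    (f *ₛ g) n + (f *ₛ h) n    ≈⟨ +-cong (*ₛ-comm f g n) (*ₛ-comm f h n) ⟩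
    (g *ₛ f) n + (h *ₛ f) n    ∎

  *ₛ-identityˡ : ∀ f → (1ₛ *ₛ f) ≈ₛ f
  *ₛ-identityˡ f zero    = trans (+-identityʳ _) (*-identityˡ (f 0))
  *ₛ-identityˡ f (suc n) = begin
    1# * f (suc n) + ((λ _ → 0#) *ₛ f) n  ≈⟨ +-cong (*-identityˡ _) (*ₛ-zeroˡ f n) ⟩
    f (suc n) + 0#                        ≈⟨ +-identityʳ _ ⟩
    f (suc n)                             ∎

  *ₛ-identityʳ : ∀ f → (f *ₛ 1ₛ) ≈ₛ f
  *ₛ-identityʳ f n = trans (*ₛ-comm f 1ₛ n) (*ₛ-identityˡ f n)

  -- (f * g) ∘ suc is f₀ (g ∘ suc) + (f ∘ suc) * g, which drives the induction.
  *ₛ-assoc : ∀ f g h → ((f *ₛ g) *ₛ h) ≈ₛ (f *ₛ (g *ₛ h))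
  *ₛ-assoc f g h zero    = +-congʳ (begin
    (f 0 * g 0 + 0#) * h 0  ≈⟨ *-congʳ (+-identityʳ _) ⟩
    f 0 * g 0 * h 0         ≈⟨ *-assoc _ _ _ ⟩
    f 0 * (g 0 * h 0)       ≈⟨ *-congˡ (+-identityʳ _) ⟨
    f 0 * (g 0 * h 0 + 0#)  ∎)
  *ₛ-assoc f g h (suc n) = begin
    (f 0 * g 0 + 0#) * h (suc n) + (((λ i → f 0 * g (suc i)) +ₛ (f⁺ *ₛ g)) *ₛ h) n
      ≈⟨ +-cong (*-congʳ (+-identityʳ _)) (*ₛ-distribʳ h (λ i → f 0 * g (suc i)) (f⁺ *ₛ g) n) ⟩
    f 0 * g 0 * h (suc n) + (((λ i → f 0 * g (suc i)) *ₛ h) n + ((f⁺ *ₛ g) *ₛ h) n)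
      ≈⟨ +-cong (*-assoc _ _ _) (+-cong (*ₛ-scaleˡ (f 0) g⁺ h n) (*ₛ-assoc f⁺ g h n)) ⟩
    f 0 * (g 0 * h (suc n)) + (f 0 * (g⁺ *ₛ h) n + (f⁺ *ₛ (g *ₛ h)) n)
      ≈⟨ +-assoc _ _ _ ⟨
    f 0 * (g 0 * h (suc n)) + f 0 * (g⁺ *ₛ h) n + (f⁺ *ₛ (g *ₛ h)) n
      ≈⟨ +-congʳ (distribˡ _ _ _) ⟨
    f 0 * (g *ₛ h) (suc n) + (f⁺ *ₛ (g *ₛ h)) n
      ∎
    where
    f⁺ = f ∘ suc
    g⁺ = g ∘ suc

  seriesRing : CommutativeRing _ _
  seriesRing = record
    { Carrier = Series
    ; _≈_ = _≈ₛ_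
    ; _+_ = _+ₛ_
    ; _*_ = _*ₛ_
    ; -_  = -ₛ_
    ; 0#  = 0ₛ
    ; 1#  = 1ₛ
    ; isCommutativeRing = record
      { isRing = record
        { +-isAbelianGroup = record
          { isGroup = record
            { isMonoid = record
              { isSemigroup = record
                { isMagma = record
                  { isEquivalence = record
                    { refl  = λ _ → refl
                    ; sym   = λ f≈g n → sym (f≈g n)
                    ; trans = λ f≈g g≈h n → trans (f≈g n) (g≈h n)
                    }
                  ; ∙-cong = λ f≈f′ g≈g′ n → +-cong (f≈f′ n) (g≈g′ n)
                  }
                ; assoc = λ f g h n → +-assoc (f n) (g n) (h n)
                }
              ; identity =
                  (λ f n → trans (+-congʳ (0ₛ≈0# n)) (+-identityˡ (f n)))
                , (λ f n → trans (+-congˡ (0ₛ≈0# n)) (+-identityʳ (f n)))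
              }
            ; inverse =
                (λ f n → trans (-‿inverseˡ (f n)) (sym (0ₛ≈0# n)))
              , (λ f n → trans (-‿inverseʳ (f n)) (sym (0ₛ≈0# n)))
            ; ⁻¹-cong = λ f≈g n → -‿cong (f≈g n)
            }
          ; comm = λ f g n → +-comm (f n) (g n)
          }
        ; *-cong = *ₛ-cong
        ; *-assoc = *ₛ-assoc
        ; *-identity = *ₛ-identityˡ , *ₛ-identityʳ
        ; distrib = *ₛ-distribˡ , *ₛ-distribʳ
        }
      ; *-comm = *ₛ-comm
      }
    }

  constantTerm-isRingHomomorphism : IsRingHomomorphism seriesRawRing rawRing (λ f → f 0)
  constantTerm-isRingHomomorphism = record
    { isSemiringHomomorphism = record
      { isNearSemiringHomomorphism = record
        { +-isMonoidHomomorphism = record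
          { isMagmaHomomorphism = record
            { isRelHomomorphism = record { cong = λ f≈g → f≈g 0 }
            ; homo = λ _ _ → refl
            }
          ; ε-homo = refl
          }
        ; *-homo = λ _ _ → +-identityʳ _
        }
      ; 1#-homo = refl
      }
    ; -‿homo = λ _ → refl
    }

-- The polynomial ring inside power series, constants, and evaluation at 0.

module PolynomialProperties (R : CommutativeRing c ℓ) where

  open CommutativeRing R
  open RingProperties ring using (-0#≈0#)
  open Polynomials rawRing using (Poly; coeff; const; add; mul; eval)
    renaming (rawRing to polyRawRing)
  open PowerSeries rawRing using () renaming (rawRing to seriesRawRing)
  open RawRing seriesRawRing using () renaming (_*_ to _*ₛ_)
  open SeriesProperties R
  open SetoidReasoning setoid

  coeff-add : ∀ p q n → coeff (add p q) n ≈ coeff p n + coeff q n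
  coeff-add []      q       n       = sym (+-identityˡ _)
  coeff-add (a ∷ p) []      n       = sym (+-identityʳ _)
  coeff-add (a ∷ p) (b ∷ q) zero    = refl
  coeff-add (a ∷ p) (b ∷ q) (suc n) = coeff-add p q n

  coeff-scale : ∀ a p n → coeff (map (a *_) p) n ≈ a * coeff p n
  coeff-scale a []      n       = sym (zeroʳ a)
  coeff-scale a (b ∷ p) zero    = refl
  coeff-scale a (b ∷ p) (suc n) = coeff-scale a p n

  coeff-neg : ∀ p n → coeff (map (-_) p) n ≈ - coeff p n
  coeff-neg []      n       = sym -0#≈0#
  coeff-neg (a ∷ p) zero    = refl
  coeff-neg (a ∷ p) (suc n) = coeff-neg p n

  -- The recursion of `mul` on its first argument matches the unfolding of the Cauchy product at its
  -- first term, since `coeff (a ∷ p) ∘ suc` is `coeff p`.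
  coeff-mul : ∀ p q n → coeff (mul p q) n ≈ (coeff p *ₛ coeff q) n
  coeff-mul []      q n       = sym (*ₛ-zeroˡ (coeff q) n)
  coeff-mul (a ∷ p) q zero    = begin
    coeff (add (map (a *_) q) (0# ∷ mul p q)) 0  ≈⟨ coeff-add (map (a *_) q) _ 0 ⟩
    coeff (map (a *_) q) 0 + 0#                  ≈⟨ +-congʳ (coeff-scale a q 0) ⟩
    a * coeff q 0 + 0#                           ∎
  coeff-mul (a ∷ p) q (suc n) = begin
    coeff (add (map (a *_) q) (0# ∷ mul p q)) (suc n)  ≈⟨ coeff-add (map (a *_) q) _ (suc n) ⟩
    coeff (map (a *_) q) (suc n) + coeff (mul p q) n   ≈⟨ +-cong (coeff-scale a q (suc n)) (coeff-mul p q n) ⟩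
    a * coeff q (suc n) + (coeff p *ₛ coeff q) n       ∎

  -- Congruence and injectivity are both `id`, because equality of polynomials is by definition
  -- equality of their coefficient series.
  coeff-isRingMonomorphism : IsRingMonomorphism polyRawRing seriesRawRing coeff
  coeff-isRingMonomorphism = record
    { isRingHomomorphism = record
      { isSemiringHomomorphism = record
        { isNearSemiringHomomorphism = record
          { +-isMonoidHomomorphism = record
            { isMagmaHomomorphism = record
              { isRelHomomorphism = record { cong = id }
              ; homo = coeff-add
              }
            ; ε-homo = λ n → sym (0ₛ≈0# n)
            }
          ; *-homo = coeff-mul
          }
        ; 1#-homo = λ { zero → refl ; (suc n) → refl }
        }
      ; -‿homo = coeff-neg
      }
    ; injective = id
    }

  polyRing : CommutativeRing _ _
  polyRing = record
    { RawRing polyRawRing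
    ; isCommutativeRing = RingMonomorphism.isCommutativeRing coeff-isRingMonomorphism
        (CommutativeRing.isCommutativeRing seriesRing)
    }

  constantTerm : Poly → Carrier
  constantTerm p = coeff p 0

  -- The constant term factors through `coeff`, so its homomorphism laws come by composition.
  -- Evaluation at 0 is handled in this form, and `eval-0` translates back.
  constantTerm-poly-isRingHomomorphism : IsRingHomomorphism polyRawRing rawRing constantTerm
  constantTerm-poly-isRingHomomorphism = Composition.isRingHomomorphism trans
    (IsRingMonomorphism.isRingHomomorphism coeff-isRingMonomorphism)
    constantTerm-isRingHomomorphism

  const-isRingHomomorphism : IsRingHomomorphism rawRing polyRawRing const
  const-isRingHomomorphism = record
    { isSemiringHomomorphism = record
      { isNearSemiringHomomorphism = record
        { +-isMonoidHomomorphism = record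
          { isMagmaHomomorphism = record
            { isRelHomomorphism = record { cong = λ { a≈b zero → a≈b ; a≈b (suc n) → refl } }
            ; homo = λ { a b zero → refl ; a b (suc n) → refl }
            }
          ; ε-homo = λ { zero → refl ; (suc n) → refl }
          }
        ; *-homo = λ { a b zero → sym (+-identityʳ _) ; a b (suc zero) → refl ; a b (suc (suc n)) → refl }
        }
      ; 1#-homo = λ { zero → refl ; (suc n) → refl }
      }
    ; -‿homo = λ { a zero → refl ; a (suc n) → refl }
    }

  eval-0 : ∀ p → eval p 0# ≈ constantTerm p
  eval-0 []      = refl
  eval-0 (a ∷ p) = trans (+-congˡ (zeroˡ (eval p 0#))) (+-identityʳ a)

-- Natural multiples of finite sums.

module CommutativeMonoidProperties (M : CommutativeMonoid c ℓ) where

  open CommutativeMonoid M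
  open CommutativeMonoidSum M using (sum; sum-cong-≋; sum-replicate; ∑-comm)
  open MonoidMult monoid using (_×_)
  open SetoidReasoning setoid

  -- A multiple is a sum of `k` equal terms, so this is an exchange of two finite sums.
  ×-distrib-sum : ∀ k {n} (f : Fin n → Carrier) → k × sum f ≈ sum (λ i → k × f i)
  ×-distrib-sum k {n} f = begin
    k × sum f                        ≈⟨ sum-replicate k ⟨
    sum {k} (λ _ → sum f)            ≈⟨ ∑-comm {k} {n} (λ _ → f) ⟩
    sum (λ i → sum {k} (λ _ → f i))  ≈⟨ sum-cong-≋ {n} (λ i → sum-replicate k {f i}) ⟩
    sum (λ i → k × f i)              ∎

-- Ring homomorphisms applied coefficientwise to series.

module HomomorphismProperties (A : CommutativeRing c ℓ) (B : CommutativeRing c′ ℓ′)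
  {φ : CommutativeRing.Carrier A → CommutativeRing.Carrier B}
  (φ-isRingHomomorphism :
    IsRingHomomorphism (CommutativeRing.rawRing A) (CommutativeRing.rawRing B) φ) where

  private
    module A = CommutativeRing A
    module B = CommutativeRing B
    module A⁺ = RawRingExtras A.rawRing
    module B⁺ = RawRingExtras B.rawRing
    module A[[t]] = RawRing (PowerSeries.rawRing A.rawRing)
    module B[[t]] = RawRing (PowerSeries.rawRing B.rawRing)
  open IsRingHomomorphism φ-isRingHomomorphism
  open SemiringSum B.semiring using (sum-cong-≋)

  ×-homo : ∀ n a → φ (n A⁺.× a) B.≈ n B⁺.× φ a
  ×-homo zero    a = 0#-homo
  ×-homo (suc n) a = B.trans (+-homo a (n A⁺.× a)) (B.+-congˡ (×-homo n a))

  sum-homo : ∀ {n} (f : Fin n → A.Carrier) → φ (A⁺.sum f) B.≈ B⁺.sum (φ ∘ f)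
  sum-homo {zero}  f = 0#-homo
  sum-homo {suc n} f = B.trans (+-homo (f zero) _) (B.+-congˡ (sum-homo (f ∘ suc)))

  -- Each coefficient of a product is a finite sum of products. The fact serves in both directions
  -- between K and K[x]: for the inclusion of constants and for the constant term.
  series-*-homo : ∀ f g → (φ ∘ (f A[[t]].* g)) B[[t]].≈ ((φ ∘ f) B[[t]].* (φ ∘ g))
  series-*-homo f g n = B.trans
    (sum-homo {suc n} (λ i → f (toℕ i) A.* g (n ∸ toℕ i)))
    (sum-cong-≋ {suc n} (λ i → *-homo (f (toℕ i)) (g (n ∸ toℕ i))))

-- Integer powers of a unit.

module IntegerPowers (R : CommutativeRing c ℓ) where

  open CommutativeRing R
  open RawRingExtras rawRing using (Unit; powℤ; _^_)
  open SemiringExp semiring using (^-homo-*)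
  open CommutativeSemigroupProperties *-commutativeSemigroup using (interchange)
  open GroupProperties (AbelianGroup.group ℤ.+-0-abelianGroup) using (//-rightDividesˡ)
  open SetoidReasoning setoid

  module _ (x : Carrier) (x-unit : Unit x) where

    private
      x⁻¹ = proj₁ x-unit

    -- Both exponents drop together, each time cancelling one factor `x * x⁻¹`. A sum of integers of
    -- opposite signs computes to some `m ⊖ n`, so this settles both mixed cases of the power law.
    powℤ-⊖ : ∀ m n → powℤ x x-unit (m ⊖ n) ≈ x ^ m * x⁻¹ ^ n
    powℤ-⊖ m       zero    = sym (*-identityʳ _)
    powℤ-⊖ zero    (suc n) = sym (*-identityˡ _)
    powℤ-⊖ (suc m) (suc n) = begin
      powℤ x x-unit (suc m ⊖ suc n)    ≡⟨ ≡.cong (powℤ x x-unit) (ℤ.[1+m]⊖[1+n]≡m⊖n m n) ⟩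
      powℤ x x-unit (m ⊖ n)            ≈⟨ powℤ-⊖ m n ⟩
      x ^ m * x⁻¹ ^ n                  ≈⟨ *-identityˡ _ ⟨
      1# * (x ^ m * x⁻¹ ^ n)           ≈⟨ *-congʳ (proj₂ x-unit) ⟨
      x * x⁻¹ * (x ^ m * x⁻¹ ^ n)      ≈⟨ interchange _ _ _ _ ⟩
      x ^ suc m * x⁻¹ ^ suc n          ∎

    powℤ-homo-+ : ∀ i j → powℤ x x-unit (i ℤ.+ j) ≈ powℤ x x-unit i * powℤ x x-unit j
    powℤ-homo-+ (+ m)    (+ n)    = ^-homo-* x m n
    powℤ-homo-+ (+ m)    -[1+ n ] = powℤ-⊖ m (suc n)
    powℤ-homo-+ -[1+ m ] (+ n)    = trans (powℤ-⊖ n (suc m)) (*-comm _ _)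
    powℤ-homo-+ -[1+ m ] -[1+ n ] = begin
      -- The two negative integers add up to `-[1+ suc (m + n) ]`; the second `suc` has to be moved
      -- next to `n` before the law for natural exponents applies.
      x⁻¹ ^ suc (suc (m ℕ.+ n))  ≡⟨ ≡.cong (λ k → x⁻¹ ^ suc k) (ℕ.+-suc m n) ⟨
      x⁻¹ ^ (suc m ℕ.+ suc n)    ≈⟨ ^-homo-* x⁻¹ (suc m) (suc n) ⟩
      x⁻¹ ^ suc m * x⁻¹ ^ suc n  ∎

    powℤ-subtract : ∀ i j → powℤ x x-unit (i ℤ.- j) * powℤ x x-unit j ≈ powℤ x x-unit i
    powℤ-subtract i j = begin
      powℤ x x-unit (i ℤ.- j) * powℤ x x-unit j  ≈⟨ powℤ-homo-+ (i ℤ.- j) j ⟨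
      powℤ x x-unit ((i ℤ.- j) ℤ.+ j)            ≡⟨ ≡.cong (powℤ x x-unit) (//-rightDividesˡ j i) ⟩
      powℤ x x-unit i                          ∎

-- The factorial formula for `_C_` is a truncated quotient. Divisibility makes it exact, and the
-- product form can then act on any ring through natural multiples, without division.
nCm*[m!*[n∸m]!]≡n! : ∀ {n m} → m ≤ n → (n C m) ℕ.* (m ! ℕ.* (n ∸ m) !) ≡ n !
nCm*[m!*[n∸m]!]≡n! {n} {m} m≤n = ≡.trans
  (≡.cong (ℕ._* (m ! ℕ.* (n ∸ m) !)) (nCk≡n!/k![n-k]! m≤n))
  (m/n*n≡m {{m ℕ.!* (n ∸ m) !≢0}} (k![n∸k]!∣n! m≤n))

-- Appell sequences and their binomial convolution.

module AppellSequences (A : CommutativeRing c ℓ) (P : CommutativeRing c′ ℓ′)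
  {φ : CommutativeRing.Carrier A → CommutativeRing.Carrier P}
  (φ-isRingHomomorphism :
    IsRingHomomorphism (CommutativeRing.rawRing A) (CommutativeRing.rawRing P) φ)
  (E : ℕ → CommutativeRing.Carrier P) where

  private
    module A where
      open CommutativeRing A public
      open PowerSeries rawRing public using (Series)
      open RawRing (PowerSeries.rawRing rawRing) public using ()
        renaming (_≈_ to _≈ₛ_; _*_ to _*ₛ_; 1# to 1ₛ)
      open RawRingExtras rawRing public using (_×_)
    module φ where
      open IsRingHomomorphism φ-isRingHomomorphism public
      open HomomorphismProperties A P φ-isRingHomomorphism public
  open CommutativeRing P
  open RawRing (PowerSeries.rawRing rawRing) using () renaming (_≈_ to _≈ₛ_; _*_ to _*ₛ_)
  open RawRingExtras rawRing using (_×_; sumUpTo)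
  open SeriesProperties P using (*ₛ-cong; *ₛ-assoc; *ₛ-comm)
  open SemiringSum semiring using (sum-cong-≋)
  open SemiringMult semiring using (×-congʳ; ×-assocˡ; ×-comm-*; ×-assoc-*)
  open CommutativeMonoidProperties +-commutativeMonoid using (×-distrib-sum)

  -- With `const` for `φ` and `exp-xt` for `E` this unfolds to the `appell` of `BernoulliMixed`.
  -- Only ring laws enter the convolution formula, so `E` stays arbitrary.
  appell : A.Series → ℕ → Carrier
  appell f n = (n !) × ((φ ∘ f) *ₛ E) n

  appell-cong : ∀ {f g} → f A.≈ₛ g → ∀ n → appell f n ≈ appell g n
  appell-cong {f} {g} f≈g n = ×-congʳ (n !)
    (*ₛ-cong {φ ∘ f} {φ ∘ g} {E} {E} (λ i → φ.⟦⟧-cong (f≈g i)) (λ _ → refl) n)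

  -- In the Cauchy product of `gE` and `φ ∘ f`, the factor `n !` of the `m`-th term splits as the
  -- binomial coefficient times `m !`, which completes `gE m` to `appell g m`, times `(n ∸ m) !`,
  -- which completes the coefficient of `f`. The sequence `a` is given only up to equality with
  -- these completed coefficients, so that values of polynomials at 0 can take its place.
  appell-* : ∀ f g {a : A.Series} → (∀ n → a n A.≈ (n !) A.× f n) → ∀ n →
    appell (f A.*ₛ g) n ≈ (∑[ m ≤ n ] ((n C m) × (φ (a (n ∸ m)) * appell g m)))
  appell-* f g {a} a≈n!f n = begin
    (n !) × ((φ ∘ (f A.*ₛ g)) *ₛ E) n
      ≈⟨ ×-congʳ (n !) (regroup n) ⟩
    (n !) × (gE *ₛ (φ ∘ f)) n
      ≈⟨ ×-distrib-sum (n !) {suc n} (λ i → gE (toℕ i) * φ (f (n ∸ toℕ i))) ⟩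
    (∑[ m ≤ n ] ((n !) × (gE m * φ (f (n ∸ m)))))
      ≈⟨ sum-cong-≋ {suc n} (λ i → term (toℕ≤pred[n] i)) ⟩
    (∑[ m ≤ n ] ((n C m) × (φ (a (n ∸ m)) * appell g m)))
      ∎
    where
    open SetoidReasoning setoid

    gE = (φ ∘ g) *ₛ E

    -- `gE` goes first so that the summation index falls on `g` and the complementary index `n ∸ m`
    -- on `f`.
    regroup : ((φ ∘ (f A.*ₛ g)) *ₛ E) ≈ₛ (gE *ₛ (φ ∘ f))
    regroup i = begin
      ((φ ∘ (f A.*ₛ g)) *ₛ E) i
        ≈⟨ *ₛ-cong {φ ∘ (f A.*ₛ g)} {(φ ∘ f) *ₛ (φ ∘ g)} {E} {E}
             (φ.series-*-homo f g) (λ _ → refl) i ⟩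
      (((φ ∘ f) *ₛ (φ ∘ g)) *ₛ E) i  ≈⟨ *ₛ-assoc (φ ∘ f) (φ ∘ g) E i ⟩
      ((φ ∘ f) *ₛ gE) i              ≈⟨ *ₛ-comm (φ ∘ f) gE i ⟩
      (gE *ₛ (φ ∘ f)) i              ∎

    term : ∀ {m} → m ≤ n →
      (n !) × (gE m * φ (f (n ∸ m))) ≈ (n C m) × (φ (a (n ∸ m)) * appell g m)
    term {m} m≤n = begin
      (n !) × (y * x)
        ≡⟨ ≡.cong (_× (y * x)) (nCm*[m!*[n∸m]!]≡n! m≤n) ⟨
      ((n C m) ℕ.* (m ! ℕ.* (n ∸ m) !)) × (y * x)
        ≈⟨ ×-assocˡ (y * x) (n C m) _ ⟨
      (n C m) × ((m ! ℕ.* (n ∸ m) !) × (y * x))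
        ≈⟨ ×-congʳ (n C m) (begin
             (m ! ℕ.* (n ∸ m) !) × (y * x)    ≈⟨ ×-assocˡ (y * x) (m !) ((n ∸ m) !) ⟨
             (m !) × (((n ∸ m) !) × (y * x))  ≈⟨ ×-congʳ (m !) (×-comm-* ((n ∸ m) !) y x) ⟨
             (m !) × (y * (((n ∸ m) !) × x))  ≈⟨ ×-assoc-* (m !) y _ ⟨
             -- `(m !) × y` is `appell g m` by definition.
             appell g m * (((n ∸ m) !) × x)   ≈⟨ *-comm _ _ ⟩
             (((n ∸ m) !) × x) * appell g m   ≈⟨ *-congʳ (φ.×-homo ((n ∸ m) !) (f (n ∸ m))) ⟨
             φ (((n ∸ m) !) A.× f (n ∸ m)) * appell g m
               ≈⟨ *-congʳ (φ.⟦⟧-cong (a≈n!f (n ∸ m))) ⟨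
             φ (a (n ∸ m)) * appell g m       ∎) ⟩
      (n C m) × (φ (a (n ∸ m)) * appell g m)
        ∎
      where
      x = φ (f (n ∸ m))
      y = gE m

  module Specialization {ε : Carrier → A.Carrier}
    (ε-isRingHomomorphism : IsRingHomomorphism rawRing A.rawRing ε)
    (ε-φ : ∀ a → ε (φ a) A.≈ a) (ε-E : (ε ∘ E) A.≈ₛ A.1ₛ) where

    private
      module ε = HomomorphismProperties P A ε-isRingHomomorphism
      module A[[t]] = SeriesProperties A
    open SemiringMult A.semiring using () renaming (×-congʳ to ×-congʳ-A)

    -- Since `ε` undoes `φ` and sends `E` to 1, it sends `(φ ∘ f) *ₛ E` back to `f`. This produces
    -- the sequences `a` that `appell-*` asks for.
    ε-appell : ∀ f n → ε (appell f n) A.≈ (n !) A.× f n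
    ε-appell f n = A.trans (ε.×-homo (n !) _) (×-congʳ-A (n !) (begin
      ε (((φ ∘ f) *ₛ E) n)              ≈⟨ ε.series-*-homo (φ ∘ f) E n ⟩
      ((ε ∘ φ ∘ f) A.*ₛ (ε ∘ E)) n
        ≈⟨ A[[t]].*ₛ-cong {ε ∘ φ ∘ f} {f} {ε ∘ E} {A.1ₛ} (ε-φ ∘ f) ε-E n ⟩
      (f A.*ₛ A.1ₛ) n                   ≈⟨ A[[t]].*ₛ-identityʳ f n ⟩
      f n                               ∎))
      where open SetoidReasoning A.setoid

-- The exponential series in K[x][[t]] and its value at x = 0.

module BernoulliMixedProperties {ℓ₁ ℓ₂ : Level} (K : HeytingField c ℓ₁ ℓ₂)
  (char0 : CharacteristicZero K) where

  open BernoulliMixed K char0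
  open CommutativeRing (commutativeRing K) hiding (zero)
  open RawRingExtras rawRing using (_×_)
  open RawRing (PowerSeries.rawRing rawRing) using () renaming (_≈_ to _≈ₛ_; 1# to 1ₛ)
  open PolynomialProperties (commutativeRing K)
  open AppellSequences (commutativeRing K) polyRing const-isRingHomomorphism exp-xt public
    using (appell-cong; appell-*; module Specialization)
  open IsRingHomomorphism constantTerm-poly-isRingHomomorphism using (*-homo)
  open SetoidReasoning setoid

  1/0!≈1 : 1/! 0 ≈ 1#
  1/0!≈1 = begin
    1/! 0             ≈⟨ *-identityˡ _ ⟨
    1# * 1/! 0        ≈⟨ *-congʳ (+-identityʳ 1#) ⟨
    -- `0 !` computes to 1, so `1/! 0` is the inverse supplied by `ℕ-unit 1`.
    (1 × 1#) * 1/! 0  ≈⟨ proj₂ (ℕ-unit 1) ⟩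
    1#                ∎

  constantTerm-exp-xt : (constantTerm ∘ exp-xt) ≈ₛ 1ₛ
  constantTerm-exp-xt zero    = begin
    -- The product of the lists `const (1/! 0)` and `X ^ₚ 0` computes; `0#` comes from the shifted
    -- summand in `mul`.
    1/! 0 * 1# + 0#  ≈⟨ +-identityʳ _ ⟩
    1/! 0 * 1#       ≈⟨ *-identityʳ _ ⟩
    1/! 0            ≈⟨ 1/0!≈1 ⟩
    1#               ∎
  constantTerm-exp-xt (suc n) = begin
    constantTerm (exp-xt (suc n))               ≈⟨ *-homo (const (1/! (suc n))) (X ^ₚ suc n) ⟩
    -- In positive degree a factor `X` splits off, and its constant term is `0#`.
    1/! (suc n) * constantTerm (X ^ₚ suc n)     ≈⟨ *-congˡ (*-homo X (X ^ₚ n)) ⟩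
    1/! (suc n) * (0# * constantTerm (X ^ₚ n))  ≈⟨ *-congˡ (zeroˡ _) ⟩
    1/! (suc n) * 0#                            ≈⟨ zeroʳ _ ⟩
    0#                                          ∎

  -- This is the hypothesis of `appell-*` on `a`, for the values at 0 of the Appell polynomials of
  -- `f`.
  eval-appell-0 : ∀ f n → eval (appell f n) 0# ≈ (n !) × f n
  eval-appell-0 f n = trans (eval-0 (appell f n))
    (Specialization.ε-appell constantTerm-poly-isRingHomomorphism
      (λ _ → refl) constantTerm-exp-xt f n)

theorem9 : ∀ {c ℓ₁ ℓ₂} (K : HeytingField c ℓ₁ ℓ₂) (char0 : CharacteristicZero K) →
    let open BernoulliMixed K char0 in
    (r s k : ℤ) (n : ℕ) →
    s[x] r k n ≈ₚ (∑[ m ≤ n ] ((n C m) ×ₚ (const (s[0] (r - s) k (n ∸ m)) *ₚ 𝔹 s m)))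
theorem9 K char0 r s k n = begin
  s[x] r k n                     ≈⟨ appell-cong {Tʳ *ₛ L} {(Tʳ⁻ˢ *ₛ L) *ₛ Tˢ} split n ⟩
  -- Here `a` is `s[0] (r - s) k`, which unfolds to the values at 0 of `appell (Tʳ⁻ˢ *ₛ L)`, while
  -- `appell Tˢ` unfolds to `𝔹 s`.
  appell ((Tʳ⁻ˢ *ₛ L) *ₛ Tˢ) n   ≈⟨ appell-* (Tʳ⁻ˢ *ₛ L) Tˢ (eval-appell-0 (Tʳ⁻ˢ *ₛ L)) n ⟩
  (∑[ m ≤ n ] ((n C m) ×ₚ (const (s[0] (r - s) k (n ∸ m)) *ₚ 𝔹 s m))) ∎
  where
  open BernoulliMixed K char0
  open BernoulliMixedProperties K char0
  open SeriesProperties (commutativeRing K) using (seriesRing; *ₛ-cong)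
  open CommutativeRing seriesRing using (*-commutativeSemigroup)
    renaming (Carrier to Series; _≈_ to _≈ₛ_; _*_ to _*ₛ_)
  open CommutativeSemigroupProperties *-commutativeSemigroup using (xy∙z≈xz∙y)
  open IntegerPowers seriesRing using (powℤ-subtract)
  open SetoidReasoning (CommutativeRing.setoid (PolynomialProperties.polyRing (commutativeRing K)))
  module K = CommutativeRing (commutativeRing K)

  Tʳ Tʳ⁻ˢ Tˢ L : Series
  Tʳ   = [t/[e^t-1]]^ r
  Tʳ⁻ˢ = [t/[e^t-1]]^ (r - s)
  Tˢ   = [t/[e^t-1]]^ s
  L    = polyBernoulliSeries k

  split : (Tʳ *ₛ L) ≈ₛ ((Tʳ⁻ˢ *ₛ L) *ₛ Tˢ)
  split i = K.trans
    (*ₛ-cong {Tʳ} {Tʳ⁻ˢ *ₛ Tˢ} {L} {L}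
      (λ j → K.sym (powℤ-subtract t/[e^t-1] t/[e^t-1]-unit r s j)) (λ _ → K.refl) i)
    -- `L` joins the factor that yields the numbers, leaving `Tˢ` alone to pair with the
    -- exponential.
    (xy∙z≈xz∙y Tʳ⁻ˢ Tˢ L i)
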